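{- Let $m\ge 0$ be an integer and let $n,k$ be integers with $0\le k<5^m$ and $0\le n<5^m$. Then for all integers $i,j$ with $0\le j\le i\le 4$, $$5 \mid \binom{n+i5^m}{k+j5^m}_F \iff 5\mid \binom{n}{k}_F.$$
   Context: The Fibonacci sequence is $F_1=F_2=1$, $F_n=F_{n-1}+F_{n-2}$ for $n\ge 3$. The fibotorial is $n!_F = F_nF_{n-1}\cdots F_1$ for $n>0$, and $0!_F=1$. The fibonomial coefficient is $\binom{n}{k}_F=\frac{n!_F}{k!_F\,(n-k)!_F}$ for $0\le k\le n$, and $\binom{n}{k}_F=0$ otherwise (in particular when $k>n$); it is always an integer. -}

module Defs where

open import Data.Bool.Base using (if_then_else_)
open import Data.Bool.Properties using (T-≡; ¬-not)
open import Data.Nat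
open import Data.Nat.DivMod using (m/n*n≡m)
open import Data.Nat.Divisibility
open import Data.Nat.Properties
open import Data.Nat.Tactic.RingSolver using (solve-∀)
open import Function.Base using (_∘_)
open import Function.Bundles using (Equivalence)
open import Relation.Binary.PropositionalEquality

-- The sequence F₁ = F₂ = 1, extended by F₀ = 0; the value F₀ does not enter
-- the fibotorial.
fib : ℕ → ℕ
fib 0             = 0
fib 1             = 1
fib (suc (suc n)) = fib (suc n) + fib n

infix 9 _!F

_!F : ℕ → ℕ
zero  !F = 1
suc n !F = fib (suc n) * n !F

fib-suc≢0 : ∀ n → NonZero (fib (suc n))
fib-suc≢0 zero    = _
fib-suc≢0 (suc n) = >-nonZero (m≤n⇒m≤n+o (fib n) (>-nonZero⁻¹ _ {{fib-suc≢0 n}}))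

_!F≢0 : ∀ n → NonZero (n !F)
zero  !F≢0 = _
suc n !F≢0 = m*n≢0 _ _ {{fib-suc≢0 n}} {{n !F≢0}}

-- The division is exact (see fibonomial-spec).
fibonomial : ℕ → ℕ → ℕ
fibonomial n k = if k ≤ᵇ n then n !F / (k !F * (n ∸ k) !F) else 0
  where instance _ = m*n≢0 (k !F) ((n ∸ k) !F) {{k !F≢0}} {{(n ∸ k) !F≢0}}

fib-+ : ∀ a b → fib (suc a + b) ≡ fib (suc a) * fib (suc b) + fib a * fib b
fib-+ 0 b = lemma (fib (suc b))
  where
  lemma : ∀ x → x ≡ 1 * x + 0
  lemma = solve-∀
fib-+ 1 b = lemma (fib (suc b)) (fib b)
  where
  lemma : ∀ x y → x + y ≡ 1 * x + 1 * y
  lemma = solve-∀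
fib-+ (suc (suc a)) b = begin
  fib (suc (suc a) + b) + fib (suc a + b)
    ≡⟨ cong₂ _+_ (fib-+ (suc a) b) (fib-+ a b) ⟩
  (fib (2 + a) * fib (suc b) + fib (suc a) * fib b) +
  (fib (suc a) * fib (suc b) + fib a * fib b)
    ≡⟨ lemma (fib (2 + a)) (fib (suc a)) (fib a) (fib (suc b)) (fib b) ⟩
  fib (3 + a) * fib (suc b) + fib (2 + a) * fib b ∎
  where
  open ≡-Reasoning
  lemma : ∀ p q r x y →
          (p * x + q * y) + (q * x + r * y) ≡ (p + q) * x + (q + r) * y
  lemma = solve-∀

!F*!F∣!F : ∀ a b → a !F * b !F ∣ (a + b) !F
!F*!F∣!F zero b = ∣-reflexive (*-identityˡ (b !F))
!F*!F∣!F (suc a) zero = ∣-reflexive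
  (trans (*-identityʳ (suc a !F)) (cong _!F (sym (+-identityʳ (suc a)))))
!F*!F∣!F (suc a) (suc b) = subst (d ∣_) (sym expand) (∣m∣n⇒∣m+n left right)
  where
  N d p q : ℕ
  N = (a + suc b) !F
  d = suc a !F * suc b !F
  p = fib (suc a)
  q = fib (suc b)

  expand : (suc a + suc b) !F ≡ fib (2 + b) * (p * N) + fib a * (q * N)
  expand = trans (cong (_* N) (fib-+ a (suc b)))
                 (lemma p (fib (2 + b)) (fib a) q N)
    where
    lemma : ∀ w x y z n → (w * x + y * z) * n ≡ x * (w * n) + y * (z * n)
    lemma = solve-∀

  left : d ∣ fib (2 + b) * (p * N)
  left = ∣n⇒∣m*n (fib (2 + b))
    (subst (_∣ p * N) (sym (*-assoc p (a !F) (suc b !F)))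
      (*-monoʳ-∣ p (!F*!F∣!F a (suc b))))

  right : d ∣ fib a * (q * N)
  right = ∣n⇒∣m*n (fib a)
    (subst (_∣ q * N) (lemma q (suc a !F) (b !F))
      (*-monoʳ-∣ q (subst (λ s → suc a !F * b !F ∣ s !F) (sym (+-suc a b))
        (!F*!F∣!F (suc a) b))))
    where
    lemma : ∀ x y z → x * (y * z) ≡ y * (x * z)
    lemma = solve-∀

fibonomial-spec : ∀ {n k} → k ≤ n → fibonomial n k * (k !F * (n ∸ k) !F) ≡ n !F
fibonomial-spec {n} {k} k≤n
  rewrite Equivalence.to T-≡ (≤⇒≤ᵇ k≤n) =
  m/n*n≡m {{m*n≢0 (k !F) ((n ∸ k) !F) {{k !F≢0}} {{(n ∸ k) !F≢0}}}}
    (subst (λ s → k !F * (n ∸ k) !F ∣ s !F) (m+[n∸m]≡n k≤n) (!F*!F∣!F k (n ∸ k)))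

fibonomial-zero : ∀ {n k} → n < k → fibonomial n k ≡ 0
fibonomial-zero {n} {k} n<k
  rewrite ¬-not (<⇒≱ n<k ∘ ≤ᵇ⇒≤ k n ∘ Equivalence.from T-≡) = refl

{-# OPTIONS --safe #-}
-- The 5-adic valuations of F_n and n agree: F_{q·5+r} is prime to 5 for 0 < r < 5,
-- and F_{5n} = 5 F_n W with W prime to 5.  Hence (r + q·5)!_F = 5^q q!_F U with U
-- prime to 5, which yields a Lucas-type rule for the lowest base-5 digits r of n
-- and s of k: the coefficient is divisible by 5 iff r < s or the coefficient of
-- the remaining digits is divisible by 5.  Stripping the lowest digit from n and k
-- leaves i and j untouched, so induction on m ends at the coefficients with top
-- index at most 4.
module Submission where

open import Data.Nat using (ℕ; _+_; _*_; _^_; _≤_; _<_)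
open import Data.Nat.Divisibility using (_∣_)
open import Function.Bundles using (_⇔_)
open import Defs

open import Data.Nat using (zero; suc; _∸_; s≤s; s≤s⁻¹; NonZero; _/_; _%_)
open import Data.Nat.Properties
open import Data.Nat.Divisibility
  using (_∣?_; _∣0; ∣m+n∣m⇒∣n; m∣m*n; ∣m⇒∣m*n)
open import Data.Nat.DivMod using (m≡m%n+[m/n]*n; m%n<n; m<n*o⇒m/o<n)
open import Data.Nat.Primality using (Prime; prime?; euclidsLemma)
open import Data.Nat.Tactic.RingSolver using (solve-∀)
open import Data.Product using (∃; _×_; _,_)
open import Data.Sum using ([_,_]′)
open import Function.Base using (_∘_; id)
open import Function.Bundles using (mk⇔)
open import Function.Construct.Composition using (_⇔-∘_)
open import Function.Construct.Symmetry using (⇔-sym)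
open import Relation.Binary.PropositionalEquality
open import Relation.Nullary using (¬_; yes; no; contradiction)
open import Relation.Nullary.Decidable using (from-yes; from-no)

-- Powers of 5 in Fibonacci numbers and fibotorials.

5-prime : Prime 5
5-prime = from-yes (prime? 5)

5∤-* : ∀ {x y} → ¬ 5 ∣ x → ¬ 5 ∣ y → ¬ 5 ∣ x * y
5∤-* {x} {y} 5∤x 5∤y = [ 5∤x , 5∤y ]′ ∘ euclidsLemma x y 5-prime

5∣-cancelʳ : ∀ {x y} → ¬ 5 ∣ y → 5 ∣ x * y → 5 ∣ x
5∣-cancelʳ {x} {y} 5∤y 5∣xy =
  [ id , (λ p → contradiction p 5∤y) ]′ (euclidsLemma x y 5-prime 5∣xy)

-- F_{n+5} = 5 F_{n+1} + 3 F_n, so indivisibility by 5 persists under steps of five from F_1, ...,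
-- F_4 = 1, 1, 2, 3.
5∤fib[suc-r+q*5] : ∀ q {r} → r < 4 → ¬ 5 ∣ fib (suc r + q * 5)
5∤fib[suc-r+q*5] zero {0} _ = from-no (5 ∣? 1)
5∤fib[suc-r+q*5] zero {1} _ = from-no (5 ∣? 1)
5∤fib[suc-r+q*5] zero {2} _ = from-no (5 ∣? 2)
5∤fib[suc-r+q*5] zero {3} _ = from-no (5 ∣? 3)
5∤fib[suc-r+q*5] zero {suc (suc (suc (suc _)))} (s≤s (s≤s (s≤s (s≤s ()))))
5∤fib[suc-r+q*5] (suc q) {r} r<4 5∣fib =
  5∤-* (from-no (5 ∣? 3)) (5∤fib[suc-r+q*5] q r<4)
    (∣m+n∣m⇒∣n (subst (5 ∣_) expand 5∣fib) (m∣m*n (fib (suc n))))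
  where
  n : ℕ
  n = suc r + q * 5

  lemma : ∀ x y → let z = y + x ; w = z + y ; v = w + z in v + w ≡ 5 * y + 3 * x
  lemma = solve-∀

  shift : ∀ r q → suc r + (5 + q) ≡ 5 + (suc r + q)
  shift = solve-∀

  expand : fib (suc r + suc q * 5) ≡ 5 * fib (suc n) + 3 * fib n
  expand = trans (cong fib (shift r (q * 5))) (lemma (fib n) (fib (suc n)))

-- 5 x (quintuple c x) is the coefficient of φ in (c + x φ)⁵ when φ² = φ + 1.
quintuple : ℕ → ℕ → ℕ
quintuple c x =
  c * c * c * c + 2 * (c * c * c * x) + 4 * (c * c * x * x) + 3 * (c * x * x * x) + x * x * x * x

-- Compares the coefficients of φ in the fifth power of φ^{n+1} = F_n + F_{n+1} φ.
fib-5* : ∀ n → fib (5 * suc n) ≡ 5 * fib (suc n) * quintuple (fib n) (fib (suc n))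
fib-5* n = trans (proj 5) (lemma c x)
  where
  c x : ℕ
  c = fib n
  x = fib (suc n)

  -- For (c + x φ)^k = a + b φ, `f` is b and `g` is a + b, the coefficient of φ after one more
  -- factor φ.
  f g : ℕ → ℕ → ℕ → ℕ
  f c x zero    = 0
  f c x (suc k) = x * g c x k + c * f c x k
  g c x zero    = 1
  g c x (suc k) = (x + c) * g c x k + x * f c x k

  proj  : ∀ k → fib (k * suc n) ≡ f c x k
  proj′ : ∀ k → fib (suc (k * suc n)) ≡ g c x k
  proj zero = refl
  proj (suc k) = trans (fib-+ n (k * suc n)) (cong₂ (λ a b → x * a + c * b) (proj′ k) (proj k))
  proj′ zero = refl
  proj′ (suc k) =
    trans (fib-+ (suc n) (k * suc n)) (cong₂ (λ a b → (x + c) * a + x * b) (proj′ k) (proj k))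

  lemma : ∀ c x →
    let f₁ = x * 1 + c * 0    ; g₁ = (x + c) * 1 + x * 0
        f₂ = x * g₁ + c * f₁  ; g₂ = (x + c) * g₁ + x * f₁
        f₃ = x * g₂ + c * f₂  ; g₃ = (x + c) * g₂ + x * f₂
        f₄ = x * g₃ + c * f₃  ; g₄ = (x + c) * g₃ + x * f₃
    in x * g₄ + c * f₄ ≡ 5 * x *
      (c * c * c * c + 2 * (c * c * c * x) + 4 * (c * c * x * x) + 3 * (c * x * x * x) + x * x * x * x)
  lemma = solve-∀

-- Modulo 5, quintuple c x is (c² + cx − x²)², and c² + cx − x² = ±1 by Cassini.
5∤quintuple : ∀ n → ¬ 5 ∣ quintuple (fib n) (fib (suc n))
5∤quintuple zero = from-no (5 ∣? 1)
5∤quintuple (suc n) 5∣W =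
  5∤quintuple n (∣m+n∣m⇒∣n (subst (5 ∣_) (lemma (fib n) (fib (suc n))) 5∣W) (m∣m*n (excess (fib n) (fib (suc n)))))
  where
  -- Passing from (c, x) to (x, x + c) negates c² + cx - x², so `quintuple` grows by a multiple of
  -- 5; `excess` is that multiple.
  excess : ℕ → ℕ → ℕ
  excess c x = c * c * c * x + 3 * (c * c * x * x) + 4 * (c * x * x * x) + 2 * (x * x * x * x)

  lemma : ∀ c x → let y = x + c in
    x * x * x * x + 2 * (x * x * x * y) + 4 * (x * x * y * y) + 3 * (x * y * y * y) + y * y * y * y
    ≡ 5 * (c * c * c * x + 3 * (c * c * x * x) + 4 * (c * x * x * x) + 2 * (x * x * x * x)) +
      (c * c * c * c + 2 * (c * c * c * x) + 4 * (c * c * x * x) + 3 * (c * x * x * x) + x * x * x * x)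
  lemma = solve-∀

-- Peels off the top factor: at an index prime to 5 it goes into u; F_{5(q+1)} gives 5 F_{q+1} to
-- the main part and its cofactor to u.
!F-5-part : ∀ q r → r ≤ 4 → ∃ λ u → ¬ 5 ∣ u × (r + q * 5) !F ≡ 5 ^ q * q !F * u
!F-5-part zero zero _ = 1 , from-no (5 ∣? 1) , refl
!F-5-part (suc q) zero _ with !F-5-part q 4 ≤-refl
... | u , 5∤u , eq = w * u , 5∤-* (5∤quintuple q) 5∤u , (begin
  fib (suc q * 5) * (4 + q * 5) !F
    ≡⟨ cong₂ _*_ (trans (cong fib (*-comm (suc q) 5)) (fib-5* q)) eq ⟩
  5 * fib (suc q) * w * (5 ^ q * q !F * u)
    ≡⟨ lemma (fib (suc q)) w (5 ^ q) (q !F) u ⟩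
  5 ^ suc q * suc q !F * (w * u) ∎)
  where
  open ≡-Reasoning
  w : ℕ
  w = quintuple (fib q) (fib (suc q))
  lemma : ∀ x w p y u → 5 * x * w * (p * y * u) ≡ 5 * p * (x * y) * (w * u)
  lemma = solve-∀
!F-5-part q (suc r) r<4 with !F-5-part q r (<⇒≤ r<4)
... | u , 5∤u , eq = fib (suc r + q * 5) * u , 5∤-* (5∤fib[suc-r+q*5] q r<4) 5∤u ,
  trans (cong (fib (suc r + q * 5) *_) eq) (lemma (fib (suc r + q * 5)) (5 ^ q * q !F) u)
  where
  lemma : ∀ x y u → x * (y * u) ≡ y * (x * u)
  lemma = solve-∀

-- Fibonomial coefficients and the lowest base-5 digit.

fibonomial-+ : ∀ a b → fibonomial (a + b) a * (a !F * b !F) ≡ (a + b) !F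
fibonomial-+ a b = subst (λ c → fibonomial (a + b) a * (a !F * c !F) ≡ (a + b) !F)
  (m+n∸m≡n a b) (fibonomial-spec (m≤m+n a b))

5∣fibonomial-zero : ∀ {n k} → n < k → 5 ∣ fibonomial n k
5∣fibonomial-zero n<k = subst (5 ∣_) (sym (fibonomial-zero n<k)) (5 ∣0)

-- Cancels the common nonzero factor of numerator and denominator; z stays arbitrary so that it can
-- absorb the extra 5 of a carry.
fibonomial-5-part : ∀ b c B C {v w z} →
  B !F ≡ 5 ^ b * b !F * v → C !F ≡ 5 ^ c * c !F * w →
  (B + C) !F ≡ 5 ^ b * b !F * (5 ^ c * c !F) * z →
  fibonomial (B + C) B * (v * w) ≡ z
fibonomial-5-part b c B C {v} {w} {z} eqᵇ eqᶜ eq = *-cancelˡ-≡ _ _ (p * q) (begin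
  p * q * (X * (v * w))       ≡⟨ lemma p q X v w ⟩
  X * ((p * v) * (q * w))     ≡⟨ cong (X *_) (cong₂ _*_ eqᵇ eqᶜ) ⟨
  X * (B !F * C !F)           ≡⟨ fibonomial-+ B C ⟩
  (B + C) !F                  ≡⟨ eq ⟩
  p * q * z                   ∎)
  where
  open ≡-Reasoning
  p q X : ℕ
  p = 5 ^ b * b !F
  q = 5 ^ c * c !F
  X = fibonomial (B + C) B
  instance
    _ : NonZero (p * q)
    _ = m*n≢0 p q {{m*n≢0 _ _ {{m^n≢0 5 b}} {{b !F≢0}}}} {{m*n≢0 _ _ {{m^n≢0 5 c}} {{c !F≢0}}}}
  lemma : ∀ p q x v w → p * q * (x * (v * w)) ≡ x * ((p * v) * (q * w))
  lemma = solve-∀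

digits-+ : ∀ s b t c → (s + b * 5) + (t + c * 5) ≡ (s + t) + (b + c) * 5
digits-+ = solve-∀

-- The quotients simply add, so the powers of 5 cancel and the two coefficients differ only by
-- factors prime to 5.
5∣fibonomial-no-carry : ∀ b c s t → s + t ≤ 4 →
  5 ∣ fibonomial ((s + b * 5) + (t + c * 5)) (s + b * 5) ⇔ 5 ∣ fibonomial (b + c) b
5∣fibonomial-no-carry b c s t s+t≤4
  with !F-5-part (b + c) (s + t) s+t≤4
     | !F-5-part b s (m+n≤o⇒m≤o s s+t≤4)
     | !F-5-part c t (m+n≤o⇒n≤o s s+t≤4)
... | u , 5∤u , eq | v , 5∤v , eqᵇ | w , 5∤w , eqᶜ = mk⇔
  (λ 5∣X → 5∣-cancelʳ 5∤u (subst (5 ∣_) X*vw≡Y*u (∣m⇒∣m*n (v * w) 5∣X)))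
  (λ 5∣Y → 5∣-cancelʳ (5∤-* 5∤v 5∤w) (subst (5 ∣_) (sym X*vw≡Y*u) (∣m⇒∣m*n u 5∣Y)))
  where
  open ≡-Reasoning
  Y : ℕ
  Y = fibonomial (b + c) b

  lemma : ∀ p q y f g u → (p * q) * (y * (f * g)) * u ≡ p * f * (q * g) * (y * u)
  lemma = solve-∀

  X*vw≡Y*u : fibonomial ((s + b * 5) + (t + c * 5)) (s + b * 5) * (v * w) ≡ Y * u
  X*vw≡Y*u = fibonomial-5-part b c (s + b * 5) (t + c * 5) eqᵇ eqᶜ (begin
    ((s + b * 5) + (t + c * 5)) !F
      ≡⟨ cong _!F (digits-+ s b t c) ⟩
    ((s + t) + (b + c) * 5) !F
      ≡⟨ eq ⟩
    5 ^ (b + c) * (b + c) !F * u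
      ≡⟨ cong₂ (λ p y → p * y * u) (^-distribˡ-+-* 5 b c) (sym (fibonomial-+ b c)) ⟩
    (5 ^ b * 5 ^ c) * (Y * (b !F * c !F)) * u
      ≡⟨ lemma (5 ^ b) (5 ^ c) Y (b !F) (c !F) u ⟩
    5 ^ b * b !F * (5 ^ c * c !F) * (Y * u) ∎)

-- The carry raises the upper quotient to b + c + 1, which leaves one 5 uncancelled.
5∣fibonomial-carry : ∀ b c {r} s t → r ≤ 4 → s ≤ 4 → t ≤ 4 → s + t ≡ 5 + r →
  5 ∣ fibonomial ((s + b * 5) + (t + c * 5)) (s + b * 5)
5∣fibonomial-carry b c {r} s t r≤4 s≤4 t≤4 s+t≡5+r
  with !F-5-part (b + suc c) r r≤4 | !F-5-part b s s≤4 | !F-5-part c t t≤4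
... | u , _ , eq | v , 5∤v , eqᵇ | w , 5∤w , eqᶜ =
  5∣-cancelʳ (5∤-* 5∤v 5∤w) (subst (5 ∣_) (sym X*vw≡5*Z) (m∣m*n Z))
  where
  open ≡-Reasoning
  Y Z : ℕ
  Y = fibonomial (b + suc c) b
  -- `fib (suc c)` is what `suc c !F` has beyond the cancelled `c !F`.
  Z = Y * fib (suc c) * u

  carry-digit : ∀ r b c → (5 + r) + (b + c) * 5 ≡ r + (b + (1 + c)) * 5
  carry-digit = solve-∀

  lemma : ∀ p q y f g h u →
    (p * (5 * q)) * (y * (f * (h * g))) * u ≡ p * f * (q * g) * (5 * (y * h * u))
  lemma = solve-∀

  X*vw≡5*Z : fibonomial ((s + b * 5) + (t + c * 5)) (s + b * 5) * (v * w) ≡ 5 * Z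
  X*vw≡5*Z = fibonomial-5-part b c (s + b * 5) (t + c * 5) eqᵇ eqᶜ (begin
    ((s + b * 5) + (t + c * 5)) !F
      ≡⟨ cong _!F (trans (digits-+ s b t c)
           (trans (cong (_+ (b + c) * 5) s+t≡5+r) (carry-digit r b c))) ⟩
    (r + (b + suc c) * 5) !F
      ≡⟨ eq ⟩
    5 ^ (b + suc c) * (b + suc c) !F * u
      ≡⟨ cong₂ (λ p y → p * y * u) (^-distribˡ-+-* 5 b (suc c)) (sym (fibonomial-+ b (suc c))) ⟩
    (5 ^ b * 5 ^ suc c) * (Y * (b !F * suc c !F)) * u
      ≡⟨ lemma (5 ^ b) (5 ^ c) Y (b !F) (c !F) (fib (suc c)) u ⟩
    5 ^ b * b !F * (5 ^ c * c !F) * (5 * Z) ∎)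

-- For b ≤ a the difference of the indices has digit r - s and quotient a - b, so no carry occurs;
-- otherwise both coefficients vanish.
5∣fibonomial-digits-≥ : ∀ a b {r s} → s ≤ r → r ≤ 4 →
  5 ∣ fibonomial (r + a * 5) (s + b * 5) ⇔ 5 ∣ fibonomial a b
5∣fibonomial-digits-≥ a b {r} {s} s≤r r≤4 with b ≤? a
... | no b≰a = mk⇔ (λ _ → 5∣fibonomial-zero (≰⇒> b≰a)) (λ _ → 5∣fibonomial-zero r+a*5<s+b*5)
  where
  r+a*5<s+b*5 : r + a * 5 < s + b * 5
  r+a*5<s+b*5 = ≤-trans (+-monoˡ-≤ (a * 5) (s≤s r≤4))
                  (≤-trans (*-monoˡ-≤ 5 (≰⇒> b≰a)) (m≤n+m (b * 5) s))
... | yes b≤a = subst₂ (λ x y → 5 ∣ fibonomial x (s + b * 5) ⇔ 5 ∣ fibonomial y b)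
  (trans (digits-+ s b (r ∸ s) (a ∸ b)) (cong₂ (λ r a → r + a * 5) (m+[n∸m]≡n s≤r) (m+[n∸m]≡n b≤a)))
  (m+[n∸m]≡n b≤a)
  (5∣fibonomial-no-carry b (a ∸ b) s (r ∸ s) (subst (_≤ 4) (sym (m+[n∸m]≡n s≤r)) r≤4))

-- Subtracting the indices borrows from a - b, so adding back carries; if b ≥ a nothing can be
-- borrowed and the coefficient is 0.
5∣fibonomial-digits-< : ∀ a b {r s} → r < s → s ≤ 4 → 5 ∣ fibonomial (r + a * 5) (s + b * 5)
5∣fibonomial-digits-< a b {r} {s} r<s s≤4 with suc b ≤? a
... | no b≮a = 5∣fibonomial-zero (+-mono-<-≤ r<s (*-monoˡ-≤ 5 (≮⇒≥ b≮a)))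
... | yes b<a = subst (λ x → 5 ∣ fibonomial x (s + b * 5)) n≡
  (5∣fibonomial-carry b c s t (≤-trans (<⇒≤ r<s) s≤4) s≤4 t≤4 s+t≡5+r)
  where
  c t : ℕ
  c = a ∸ suc b
  t = 5 + r ∸ s

  s+t≡5+r : s + t ≡ 5 + r
  s+t≡5+r = m+[n∸m]≡n (≤-trans s≤4 (m≤n⇒m≤n+o r (n≤1+n 4)))

  t≤4 : t ≤ 4
  t≤4 = ≤-trans (∸-monoʳ-≤ (5 + r) r<s) (≤-reflexive (m+n∸n≡m 4 r))

  carry-digit : ∀ r b c → (5 + r) + (b + c) * 5 ≡ r + (1 + b + c) * 5
  carry-digit = solve-∀

  n≡ : (s + b * 5) + (t + c * 5) ≡ r + a * 5
  n≡ = trans (digits-+ s b t c) (trans (cong (_+ (b + c) * 5) s+t≡5+r)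
         (trans (carry-digit r b c) (cong (λ a → r + a * 5) (m+[n∸m]≡n b<a))))

-- The coefficient divides i!_F, a product of numbers among F_1, ..., F_4.
5∤fibonomial-single-digit : ∀ i j → j ≤ i → i ≤ 4 → ¬ 5 ∣ fibonomial i j
5∤fibonomial-single-digit i j j≤i i≤4 5∣X = 5∤!F i≤4
  (subst (5 ∣_) (fibonomial-spec j≤i) (∣m⇒∣m*n (j !F * (i ∸ j) !F) 5∣X))
  where
  5∤!F : ∀ {i} → i ≤ 4 → ¬ 5 ∣ i !F
  5∤!F {zero}  _   = from-no (5 ∣? 1)
  5∤!F {suc i} i<4 = 5∤-* (subst (λ x → ¬ 5 ∣ fib x) (+-identityʳ (suc i)) (5∤fib[suc-r+q*5] 0 i<4))
                       (5∤!F (<⇒≤ i<4))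

corollary3p2 : (m n k : ℕ) → k < 5 ^ m → n < 5 ^ m →
    (i j : ℕ) → j ≤ i → i ≤ 4 →
    5 ∣ fibonomial (n + i * 5 ^ m) (k + j * 5 ^ m) ⇔ 5 ∣ fibonomial n k
corollary3p2 zero zero zero _ _ i j j≤i i≤4
  rewrite *-identityʳ i | *-identityʳ j =
  mk⇔ (λ 5∣X → contradiction 5∣X (5∤fibonomial-single-digit i j j≤i i≤4))
      (λ 5∣1 → contradiction 5∣1 (from-no (5 ∣? 1)))
corollary3p2 zero (suc _) _ _ (s≤s ()) _ _ _ _
corollary3p2 zero zero (suc _) (s≤s ()) _ _ _ _ _
corollary3p2 (suc m) n k k< n< i j j≤i i≤4 =
  subst₂ _⇔_
    (cong₂ (λ x y → 5 ∣ fibonomial x y) (sym (split n i)) (sym (split k j)))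
    (cong₂ (λ x y → 5 ∣ fibonomial x y) (sym (m≡m%n+[m/n]*n n 5)) (sym (m≡m%n+[m/n]*n k 5)))
    strip
  where
  M : ℕ
  M = 5 ^ m

  lemma : ∀ r q i M → (r + q * 5) + i * (5 * M) ≡ r + (q + i * M) * 5
  lemma = solve-∀

  split : ∀ n i → n + i * 5 ^ suc m ≡ n % 5 + (n / 5 + i * M) * 5
  split n i = trans (cong (_+ i * 5 ^ suc m) (m≡m%n+[m/n]*n n 5)) (lemma (n % 5) (n / 5) i M)

  n/5< : ∀ {n} → n < 5 ^ suc m → n / 5 < M
  n/5< {n} n< = m<n*o⇒m/o<n (subst (n <_) (*-comm 5 M) n<)

  n%5≤4 : ∀ n → n % 5 ≤ 4
  n%5≤4 n = s≤s⁻¹ (m%n<n n 5)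

  strip : 5 ∣ fibonomial (n % 5 + (n / 5 + i * M) * 5) (k % 5 + (k / 5 + j * M) * 5) ⇔
          5 ∣ fibonomial (n % 5 + (n / 5) * 5) (k % 5 + (k / 5) * 5)
  -- Both sides share their lowest digits: either these drop out and induction applies to the
  -- quotients, or they force divisibility on both sides.
  strip with k % 5 ≤? n % 5
  ... | yes s≤r =
    ⇔-sym (5∣fibonomial-digits-≥ (n / 5) (k / 5) s≤r (n%5≤4 n))
    ⇔-∘ (corollary3p2 m (n / 5) (k / 5) (n/5< k<) (n/5< n<) i j j≤i i≤4
    ⇔-∘ 5∣fibonomial-digits-≥ (n / 5 + i * M) (k / 5 + j * M) s≤r (n%5≤4 n))
  ... | no s≰r = mk⇔ (λ _ → 5∣fibonomial-digits-< (n / 5) (k / 5) (≰⇒> s≰r) (n%5≤4 k))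
                     (λ _ → 5∣fibonomial-digits-< (n / 5 + i * M) (k / 5 + j * M) (≰⇒> s≰r) (n%5≤4 k))
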